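{- The following Cartesian products $K^{d_1+1}\times K^{d_2+1}$ of complete graphs are not $\lfloor (d_1+d_2+1)/2\rfloor$-linked: (i) $K^{2}\times K^{d_2+1}$ (that is, $d_1=1$) for every even integer $d_2\ge 1$; (ii) $K^{3}\times K^{d_2+1}$ (that is, $d_1=2$) for each $d_2\in\{1,3,5,7,9\}$.
   Context: $K^{t}$ denotes the complete graph on $t$ vertices. The Cartesian product $G_1\times G_2$ of two graphs is the graph whose vertices are the pairs $(v_1,v_2)$ with $v_i\in V(G_i)$, where $(u_1,u_2)$ and $(v_1,v_2)$ are adjacent if, for some $\ell\in\{1,2\}$, $u_\ell v_\ell\in E(G_\ell)$ and $u_i=v_i$ for $i\neq \ell$. For an integer $k\ge 0$, a graph $G$ is $k$-linked if it has at least $2k$ vertices and, for every set $X$ of exactly $2k$ distinct vertices of $G$ and every partition of $X$ into pairs $\{s_1,t_1\},\ldots,\{s_k,t_k\}$, there exist $k$ pairwise vertex-disjoint paths $L_1,\ldots,L_k$ in $G$ such that $L_i$ joins $s_i$ to $t_i$ for each $i\in\{1,\ldots,k\}$. -}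

module Defs where

open import Data.Fin.Base using (Fin)
open import Data.Fin.Properties using (*↔×)
open import Data.List.Base using (List; head; last)
open import Data.List.Relation.Binary.Disjoint.Propositional using (Disjoint)
open import Data.List.Relation.Unary.Linked using (Linked)
open import Data.List.Relation.Unary.Unique.Propositional using (Unique)
open import Data.Maybe.Base using (just)
open import Data.Nat.Base using (ℕ; _+_; _*_; _≤_)
open import Data.Product.Base using (_×_; _,_; Σ-syntax)
open import Data.Product.Function.NonDependent.Propositional using (_×-↔_)
open import Data.Sum.Base using (_⊎_; inj₁; inj₂; [_,_]′)
open import Function.Base using (_∘_)
open import Function.Bundles using (_↔_)
open import Function.Definitions using (Injective)
open import Function.Properties.Inverse using (↔-refl; ↔-trans)
open import Level using (0ℓ)
open import Relation.Binary.Core using (Rel)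
open import Relation.Binary.Definitions using (Symmetric; Irreflexive)
open import Relation.Binary.PropositionalEquality using (_≡_; _≢_; refl; sym)

record Graph : Set₁ where
  field
    Vertex     : Set
    order      : ℕ
    enumerate  : Fin order ↔ Vertex
    Adjacent   : Rel Vertex 0ℓ
    adj-sym    : Symmetric Adjacent
    adj-irrefl : Irreflexive _≡_ Adjacent

K : ℕ → Graph
K t = record
  { Vertex     = Fin t
  ; order      = t
  ; enumerate  = ↔-refl
  ; Adjacent   = _≢_
  ; adj-sym    = λ u≢v → u≢v ∘ sym
  ; adj-irrefl = λ u≡v u≢v → u≢v u≡v
  }

infixr 7 _□_

_□_ : Graph → Graph → Graph
G □ H = record
  { Vertex     = G.Vertex × H.Vertex
  ; order      = G.order * H.order
  ; enumerate  = ↔-trans *↔× (G.enumerate ×-↔ H.enumerate)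
  ; Adjacent   = Adj
  ; adj-sym    = adj-sym
  ; adj-irrefl = adj-irrefl
  }
  where
  module G = Graph G
  module H = Graph H

  Adj : Rel (G.Vertex × H.Vertex) 0ℓ
  Adj (u₁ , u₂) (v₁ , v₂) =
    (G.Adjacent u₁ v₁ × u₂ ≡ v₂) ⊎ (H.Adjacent u₂ v₂ × u₁ ≡ v₁)

  adj-sym : Symmetric Adj
  adj-sym (inj₁ (a , e)) = inj₁ (G.adj-sym a , sym e)
  adj-sym (inj₂ (a , e)) = inj₂ (H.adj-sym a , sym e)

  adj-irrefl : Irreflexive _≡_ Adj
  adj-irrefl refl (inj₁ (a , _)) = G.adj-irrefl refl a
  adj-irrefl refl (inj₂ (a , _)) = H.adj-irrefl refl a

module _ (G : Graph) where
  open Graph G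

  -- `Linked` is the standard library's predicate that consecutive list
  -- entries are related; it is unrelated to k-linkedness.
  record Path (u v : Vertex) : Set where
    field
      vertices    : List Vertex
      starts      : head vertices ≡ just u
      ends        : last vertices ≡ just v
      consecutive : Linked Adjacent vertices
      distinct    : Unique vertices

  -- A set X of exactly 2k vertices partitioned into pairs {s i , t i} is
  -- given by s and t such that the copairing [ s , t ]′ is injective.
  IsLinked : ℕ → Set
  IsLinked k =
    2 * k ≤ order ×
    (∀ (s t : Fin k → Vertex) → Injective _≡_ _≡_ [ s , t ]′ →
      Σ[ L ∈ (∀ i → Path (s i) (t i)) ]
        (∀ {i j} → i ≢ j → Disjoint (Path.vertices (L i)) (Path.vertices (L j))))

{-# OPTIONS --safe #-}

-- The terminals are packed into few columns (copies of the small factor) so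
-- that each path must change rows inside one of the remaining, free columns.
-- A column has at most three vertices, so two disjoint paths cannot both change
-- rows in it, and there are fewer free columns than paths.  For K³ × K² there is
-- no free column; there both paths are forced through the same free vertex.
module Submission where

open import Defs
open import Data.Fin using (#_)
open import Data.Fin.Base as Fin using (Fin; zero; suc; _↑ˡ_; _↑ʳ_; splitAt; fromℕ; inject₁)
open import Data.Fin.Properties
  using (_≟_; all?; pigeonhole; <⇒≢; splitAt⁻¹-↑ˡ; splitAt⁻¹-↑ʳ; ↑ˡ-injective;
         fromℕ≢inject₁; inject₁-injective; suc-injective)
open import Data.Fin.Relation.Unary.Top using (view; ‵fromℕ; ‵inject₁)
open import Data.List.Base using (List; _∷_; []; head; last)
open import Data.List.Membership.Propositional using (_∈_)
import Data.List.Relation.Binary.Disjoint.DecPropositional as DecDisjoint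
open import Data.List.Relation.Binary.Disjoint.Propositional using (Disjoint)
open import Data.List.Relation.Binary.Subset.Propositional using (_⊆_)
open import Data.List.Relation.Unary.Any using (here; there)
open import Data.List.Relation.Unary.Linked using (Linked; [-]; _∷_)
open import Data.Maybe.Base using (just)
open import Data.Nat.Base using (ℕ; suc; _+_; _*_; _≥_; _<_; ⌊_/2⌋)
open import Data.Nat.Divisibility using (_∣_; divides-refl)
open import Data.Nat.Properties using (n<1+n; +-comm; *-comm; +-identityʳ)
open import Data.Product.Base using (_×_; _,_; ∃-syntax; proj₁; proj₂)
open import Data.Product.Properties using (≡-dec)
open import Data.Sum.Base using (inj₁; inj₂; [_,_]′)
open import Data.Vec.Base using (Vec; _∷_; []; lookup)
open import Function.Base using (_∘_)
open import Function.Definitions using (Injective)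
open import Level using (0ℓ)
open import Relation.Binary.Core using (Rel)
open import Relation.Binary.PropositionalEquality
  using (_≡_; _≢_; refl; sym; trans; cong; subst₂)
open import Relation.Nullary.Decidable
  using (Dec; yes; no; ¬?; _×-dec_; _→-dec_; True; toWitness; from-yes)
open import Relation.Nullary.Negation using (¬_; contradiction)
open import Relation.Unary using (Pred; Decidable)

-- Paths leaving a set of vertices

module _ {A : Set} where

  head∈ : ∀ {xs : List A} {u} → head xs ≡ just u → u ∈ xs
  head∈ {_ ∷ _} refl = here refl

  last∈ : ∀ {xs : List A} {u} → last xs ≡ just u → u ∈ xs
  last∈ {_ ∷ []}    refl = here refl
  last∈ {_ ∷ _ ∷ _} eq   = there (last∈ eq)

  -- Membership of the two ends suffices, since disjointness of paths is all that is tested later.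
  Crossing : Rel A 0ℓ → Pred A 0ℓ → List A → Set
  Crossing R P xs = ∃[ x ] ∃[ y ] x ∷ y ∷ [] ⊆ xs × R x y × P x × ¬ P y

  linked-crossing : ∀ {R : Rel A 0ℓ} {P : Pred A 0ℓ} → Decidable P →
    ∀ {xs u v} → Linked R xs → head xs ≡ just u → last xs ≡ just v →
    P u → ¬ P v → Crossing R P xs
  linked-crossing P? [-] refl refl Pu ¬Pv = contradiction Pu ¬Pv
  linked-crossing P? {u ∷ w ∷ _} (Ruw ∷ ws) refl eq Pu ¬Pv with P? w
  ... | no ¬Pw = u , w ,
        (λ { (here refl) → here refl ; (there (here refl)) → there (here refl) }) ,
        Ruw , Pu , ¬Pw
  ... | yes Pw with x , y , sub , rest ← linked-crossing P? ws refl eq Pw ¬Pv =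
        x , y , there ∘ sub , rest

-- What disjointness of the paths imposes on every vertex of the `i`-th one.
Avoids : {V : Set} {k : ℕ} (s t : Fin k → V) → Fin k → Pred V 0ℓ
Avoids s t i v = ∀ j → j ≢ i → v ≢ s j × v ≢ t j

module _ (G : Graph) {k : ℕ} (s t : Fin k → Graph.Vertex G) where
  open Graph G

  -- Each path has to leave its set `P i`, and the edge by which it does so belongs to a gate. By
  -- the pigeonhole principle two paths use the same gate, where their edges share a vertex.
  gates⇒¬linked : ∀ {m} → m < k → Injective _≡_ _≡_ [ s , t ]′ →
    (P : Fin k → Pred Vertex 0ℓ) → (∀ i → Decidable (P i)) →
    (∀ i → P i (s i)) → (∀ i → ¬ P i (t i)) →
    (Gate : Fin m → Rel Vertex 0ℓ) →
    (∀ i {x y} → Adjacent x y → P i x → ¬ P i y →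
      Avoids s t i x → Avoids s t i y → ∃[ c ] Gate c x y) →
    (∀ {c x y x′ y′} → Gate c x y → Gate c x′ y′ →
      ¬ Disjoint (x ∷ y ∷ []) (x′ ∷ y′ ∷ [])) →
    ¬ IsLinked G k
  gates⇒¬linked m<k inj P P? Ps ¬Pt Gate gate meet (_ , linked)
    with L , L-disjoint ← linked s t inj =
    let _ , _ , i<j , eq = pigeonhole m<k (proj₁ ∘ gates) in
    clash (<⇒≢ i<j) (gates _) (gates _) eq
    where
    module L i = Path (L i)

    avoids : ∀ i {v} → v ∈ L.vertices i → Avoids s t i v
    avoids i v∈ j j≢i =
      (λ { refl → L-disjoint j≢i (head∈ (L.starts j) , v∈) }) ,
      (λ { refl → L-disjoint j≢i (last∈ (L.ends j) , v∈) })

    Gated : Fin k → Set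
    Gated i = ∃[ c ] ∃[ x ] ∃[ y ] x ∷ y ∷ [] ⊆ L.vertices i × Gate c x y

    gates : ∀ i → Gated i
    gates i
      with x , y , sub , adj , Px , ¬Py ←
        linked-crossing (P? i) (L.consecutive i) (L.starts i) (L.ends i) (Ps i) (¬Pt i)
      with c , g ← gate i adj Px ¬Py
        (avoids i (sub (here refl))) (avoids i (sub (there (here refl)))) =
      c , x , y , sub , g

    clash : ∀ {i j} → i ≢ j → (g : Gated i) (g′ : Gated j) → proj₁ g ≢ proj₁ g′
    clash i≢j (_ , _ , _ , sub , g) (_ , _ , _ , sub′ , g′) refl =
      meet g g′ λ (v∈ , v∈′) → L-disjoint i≢j (sub v∈ , sub′ v∈′)

-- Changing rows in a product with few rows

-- True exactly for `a` at most 3, because two disjoint pairs need four elements.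
PairsMeet : ℕ → Set
PairsMeet a = ∀ (r r′ q q′ : Fin a) → r ≢ r′ → q ≢ q′ →
  ¬ Disjoint (r ∷ r′ ∷ []) (q ∷ q′ ∷ [])

pairsMeet? : ∀ a → Dec (PairsMeet a)
pairsMeet? a = all? λ r → all? λ r′ → all? λ q → all? λ q′ →
  ¬? (r ≟ r′) →-dec ¬? (q ≟ q′) →-dec ¬? (DecDisjoint.disjoint? _≟_ _ _)

-- The columns `c ↑ˡ m` are the occupied ones, the columns `p ↑ʳ c` the free ones.
module _ {a k p m : ℕ} (s t : Fin k → Fin a × Fin (p + m)) where

  ChangesRow : Set
  ChangesRow = ∀ i → proj₁ (t i) ≢ proj₁ (s i)

  Confined : Set
  Confined = ∀ i (c : Fin p) r → r ≢ proj₁ (s i) →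
    Avoids s t i (proj₁ (s i) , c ↑ˡ m) → ¬ Avoids s t i (r , c ↑ˡ m)

  -- The set to leave is the row of `s i`, and the gates are the free columns: `Confined` rules out
  -- leaving that row in an occupied column, and `PairsMeet` makes any two row changes in one column
  -- collide.
  confined⇒¬linked : PairsMeet a → m < k → Injective _≡_ _≡_ [ s , t ]′ →
    ChangesRow → Confined → ¬ IsLinked (K a □ K (p + m)) k
  confined⇒¬linked pairsMeet m<k inj changes confined =
    gates⇒¬linked (K a □ K (p + m)) s t m<k inj
      (λ i v → proj₁ v ≡ proj₁ (s i)) (λ i v → proj₁ v ≟ proj₁ (s i))
      (λ _ → refl) changes Gate gate meet
    where
    Gate : Fin m → Rel (Fin a × Fin (p + m)) 0ℓ
    Gate c (r , x) (r′ , y) = r ≢ r′ × x ≡ p ↑ʳ c × y ≡ p ↑ʳ c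

    gate : ∀ i {x y} → Graph.Adjacent (K a □ K (p + m)) x y →
      proj₁ x ≡ proj₁ (s i) → proj₁ y ≢ proj₁ (s i) →
      Avoids s t i x → Avoids s t i y → ∃[ c ] Gate c x y
    gate i (inj₂ (_ , refl)) Px ¬Py _ _ = contradiction Px ¬Py
    gate i {_ , x} (inj₁ (r≢r′ , refl)) refl ¬Py av-x av-y with splitAt p x in eq
    ... | inj₂ c = c , r≢r′ , sym (splitAt⁻¹-↑ʳ eq) , sym (splitAt⁻¹-↑ʳ eq)
    ... | inj₁ c with refl ← splitAt⁻¹-↑ˡ {p} eq =
          contradiction av-y (confined i c _ ¬Py av-x)

    meet : ∀ {c x y x′ y′} → Gate c x y → Gate c x′ y′ →
      ¬ Disjoint (x ∷ y ∷ []) (x′ ∷ y′ ∷ [])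
    meet {c} (r≢ , refl , refl) (q≢ , refl , refl) disj =
      pairsMeet _ _ _ _ r≢ q≢ λ (v∈ , v∈′) → disj (∈-column v∈ , ∈-column v∈′)
      where
      ∈-column : ∀ {v r r′} → v ∈ r ∷ r′ ∷ [] →
        (v , p ↑ʳ c) ∈ (r , p ↑ʳ c) ∷ (r′ , p ↑ʳ c) ∷ []
      ∈-column (here refl)         = here refl
      ∈-column (there (here refl)) = there (here refl)

-- Two rows

cycle : ∀ {q} → Fin (suc q) → Fin (suc q)
cycle zero    = fromℕ _
cycle (suc i) = inject₁ i

cycle-injective : ∀ {q} {i j : Fin (suc q)} → cycle i ≡ cycle j → i ≡ j
cycle-injective {i = zero}  {zero}  _  = refl
cycle-injective {i = zero}  {suc _} eq = contradiction eq fromℕ≢inject₁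
cycle-injective {i = suc _} {zero}  eq = contradiction (sym eq) fromℕ≢inject₁
cycle-injective {i = suc _} {suc _} eq = cong suc (inject₁-injective eq)

-- `cycle` subtracts one modulo the number of elements; it has no fixed point once there are two
-- elements, hence the double `suc`.
cycle-predecessor : ∀ {q} (i : Fin (suc (suc q))) → ∃[ j ] j ≢ i × cycle j ≡ i
cycle-predecessor i with view i
... | ‵fromℕ     = zero , (λ ()) , refl
... | ‵inject₁ j = suc j , suc≢inject₁ j , refl
  where
  suc≢inject₁ : ∀ {n} (j : Fin n) → suc j ≢ inject₁ j
  suc≢inject₁ (suc j) eq = suc≢inject₁ j (suc-injective eq)

-- The sources fill one row of the occupied columns and the targets the other, shifted cyclically so
-- that no column contains both ends of a pair.
K²□K¬linked : ∀ q → ¬ IsLinked (K 2 □ K (suc (suc q) + suc q)) (suc (suc q))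
K²□K¬linked q = confined⇒¬linked s t (from-yes (pairsMeet? 2)) (n<1+n _)
  inj (λ _ ()) confined
  where
  s t : Fin (suc (suc q)) → Fin 2 × Fin (suc (suc q) + suc q)
  s i = zero     , i ↑ˡ suc q
  t i = suc zero , cycle i ↑ˡ suc q

  inj : Injective _≡_ _≡_ [ s , t ]′
  inj {inj₁ i} {inj₁ j} eq = cong inj₁ (↑ˡ-injective _ i j (cong proj₂ eq))
  inj {inj₂ i} {inj₂ j} eq =
    cong inj₂ (cycle-injective (↑ˡ-injective _ _ _ (cong proj₂ eq)))

  confined : Confined s t
  confined i c zero       r≢ _  _   = r≢ refl
  confined i c (suc zero) _  av av′ with c ≟ i
  ... | no c≢i = proj₁ (av c c≢i) refl
  -- In the column of `s i` itself, the other vertex is the target of a different pair.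
  ... | yes refl with j , j≢c , eq ← cycle-predecessor c =
        proj₂ (av′ j j≢c) (cong (λ x → suc zero , x ↑ˡ suc q) (sym eq))

-- Three rows

module _ {k n : ℕ} (s t : Fin k → Fin 3 × Fin n) where

  private
    _≟ᵥ_ = ≡-dec (_≟_ {3}) (_≟_ {n})

  -- Injectivity of the copairing, unfolded into quantifiers over `Fin k` so that it can be decided
  -- by evaluation.
  Distinct : Set
  Distinct = (∀ i j → s i ≡ s j → i ≡ j) × (∀ i j → t i ≡ t j → i ≡ j) ×
             (∀ i j → s i ≢ t j)

  distinct? : Dec Distinct
  distinct? = (all? λ i → all? λ j → (s i ≟ᵥ s j) →-dec (i ≟ j)) ×-dec
              (all? λ i → all? λ j → (t i ≟ᵥ t j) →-dec (i ≟ j)) ×-dec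
              (all? λ i → all? λ j → ¬? (s i ≟ᵥ t j))

  distinct⇒injective : Distinct → Injective _≡_ _≡_ [ s , t ]′
  distinct⇒injective (ss , tt , st) {inj₁ i} {inj₁ j} eq = cong inj₁ (ss i j eq)
  distinct⇒injective (ss , tt , st) {inj₁ i} {inj₂ j} eq = contradiction eq (st i j)
  distinct⇒injective (ss , tt , st) {inj₂ i} {inj₁ j} eq = contradiction (sym eq) (st j i)
  distinct⇒injective (ss , tt , st) {inj₂ i} {inj₂ j} eq = cong inj₂ (tt i j eq)

  avoids? : ∀ i → Decidable (Avoids s t i)
  avoids? i v = all? λ j → ¬? (j ≟ i) →-dec (¬? (v ≟ᵥ s j) ×-dec ¬? (v ≟ᵥ t j))

module _ {k p m : ℕ} (pairs : Vec ((Fin 3 × Fin (p + m)) × (Fin 3 × Fin (p + m))) k) where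

  private
    s t : Fin k → Fin 3 × Fin (p + m)
    s = proj₁ ∘ lookup pairs
    t = proj₂ ∘ lookup pairs

  Obstructs : Set
  Obstructs = Distinct s t × ChangesRow {p = p} s t × Confined {p = p} s t

  obstructs? : Dec Obstructs
  obstructs? = distinct? s t
    ×-dec (all? λ i → ¬? (proj₁ (t i) ≟ proj₁ (s i)))
    ×-dec (all? λ i → all? λ c → all? λ r → ¬? (r ≟ proj₁ (s i)) →-dec
            avoids? s t i (proj₁ (s i) , c ↑ˡ m) →-dec ¬? (avoids? s t i (r , c ↑ˡ m)))

  obstructs⇒¬linked : m < k → {True obstructs?} → ¬ IsLinked (K 3 □ K (p + m)) k
  obstructs⇒¬linked m<k {ok} with dist , changes , confined ← toWitness ok =
    confined⇒¬linked s t (from-yes (pairsMeet? 3)) m<k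
      (distinct⇒injective s t dist) changes confined

-- The terminals form a 4-cycle in which partners are opposite, so both cycle neighbours of a source
-- belong to the other pair. Its only other neighbour is `(# 2 , # 0)`, the same for both sources;
-- taking `P i` to be the source alone makes this vertex the single gate.
K³□K²¬linked : ¬ IsLinked (K 3 □ K 2) 2
K³□K²¬linked = gates⇒¬linked (K 3 □ K 2) s t (n<1+n 1)
  (distinct⇒injective s t (from-yes (distinct? s t)))
  (λ i v → v ≡ s i) (λ i v → ≡-dec _≟_ _≟_ v (s i)) (λ _ → refl)
  (λ { zero () ; (suc zero) () })
  (λ _ _ y → y ≡ (# 2 , # 0)) gate
  (λ { refl refl disj → disj (there (here refl) , there (here refl)) })
  where
  s t : Fin 2 → Fin 3 × Fin 2
  s = lookup ((# 0 , # 0) ∷ (# 1 , # 0) ∷ [])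
  t = lookup ((# 1 , # 1) ∷ (# 0 , # 1) ∷ [])

  gate : ∀ i {x y} → Graph.Adjacent (K 3 □ K 2) x y → x ≡ s i → y ≢ s i →
    Avoids s t i x → Avoids s t i y → ∃[ c ] y ≡ (# 2 , # 0)
  gate i {y = suc (suc zero) , zero} _ _ _ _ _ = zero , refl
  gate zero {y = zero , zero} _ _ y≢ _ _ = contradiction refl y≢
  gate zero {y = suc zero , zero} _ _ _ _ av = contradiction refl (proj₁ (av (# 1) λ ()))
  gate zero {y = zero , suc zero} _ _ _ _ av = contradiction refl (proj₂ (av (# 1) λ ()))
  gate zero {y = suc _ , suc zero} (inj₁ (_ , ())) refl _ _ _
  gate zero {y = suc _ , suc zero} (inj₂ (_ , ())) refl _ _ _
  gate (suc zero) {y = zero , zero} _ _ _ _ av = contradiction refl (proj₁ (av (# 0) λ ()))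
  gate (suc zero) {y = suc zero , zero} _ _ y≢ _ _ = contradiction refl y≢
  gate (suc zero) {y = suc zero , suc zero} _ _ _ _ av = contradiction refl (proj₂ (av (# 0) λ ()))
  gate (suc zero) {y = zero , suc zero} (inj₁ (_ , ())) refl _ _ _
  gate (suc zero) {y = zero , suc zero} (inj₂ (_ , ())) refl _ _ _
  gate (suc zero) {y = suc (suc zero) , suc zero} (inj₁ (_ , ())) refl _ _ _
  gate (suc zero) {y = suc (suc zero) , suc zero} (inj₂ (_ , ())) refl _ _ _

-- Columns 0 and 1 are full.  Any other occupied column holds two terminals, and
-- the partner of each of them lies in a full column and in the row of the other,
-- so that the column's third vertex is of no use to either.

K³□K⁴¬linked : ¬ IsLinked (K 3 □ K 4) 3
K³□K⁴¬linked = obstructs⇒¬linked {p = 2} {m = 2}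
  ( ((# 0 , # 0) , (# 1 , # 1))
  ∷ ((# 1 , # 0) , (# 2 , # 1))
  ∷ ((# 2 , # 0) , (# 0 , # 1))
  ∷ []) (n<1+n 2)

K³□K⁶¬linked : ¬ IsLinked (K 3 □ K 6) 4
K³□K⁶¬linked = obstructs⇒¬linked {p = 3} {m = 3}
  ( ((# 1 , # 0) , (# 0 , # 2))
  ∷ ((# 0 , # 1) , (# 1 , # 2))
  ∷ ((# 0 , # 0) , (# 2 , # 1))
  ∷ ((# 2 , # 0) , (# 1 , # 1))
  ∷ []) (n<1+n 3)

K³□K⁸¬linked : ¬ IsLinked (K 3 □ K 8) 5
K³□K⁸¬linked = obstructs⇒¬linked {p = 4} {m = 4}
  ( ((# 1 , # 0) , (# 0 , # 2))
  ∷ ((# 0 , # 0) , (# 1 , # 2))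
  ∷ ((# 2 , # 1) , (# 0 , # 3))
  ∷ ((# 0 , # 1) , (# 2 , # 3))
  ∷ ((# 2 , # 0) , (# 1 , # 1))
  ∷ []) (n<1+n 4)

K³□K¹⁰¬linked : ¬ IsLinked (K 3 □ K 10) 6
K³□K¹⁰¬linked = obstructs⇒¬linked {p = 5} {m = 5}
  -- The six vertices of columns 0 and 1 are now all partners of the six terminals in columns 2, 3
  -- and 4, so this pattern has no room for a further column.
  ( ((# 1 , # 0) , (# 0 , # 2))
  ∷ ((# 0 , # 0) , (# 1 , # 2))
  ∷ ((# 2 , # 1) , (# 0 , # 3))
  ∷ ((# 0 , # 1) , (# 2 , # 3))
  ∷ ((# 2 , # 0) , (# 1 , # 4))
  ∷ ((# 1 , # 1) , (# 2 , # 4))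
  ∷ []) (n<1+n 5)

n*2≡n+n : ∀ n → n * 2 ≡ n + n
n*2≡n+n n = trans (*-comm n 2) (cong (n +_) (+-identityʳ n))

mainTheorem2 : (∀ (d₂ : ℕ) → d₂ ≥ 1 → 2 ∣ d₂ →
    ¬ IsLinked (K (1 + 1) □ K (d₂ + 1)) ⌊ 1 + d₂ + 1 /2⌋)
    × (∀ (d₂ : ℕ) → d₂ ∈ (1 ∷ 3 ∷ 5 ∷ 7 ∷ 9 ∷ []) →
    ¬ IsLinked (K (2 + 1) □ K (d₂ + 1)) ⌊ 2 + d₂ + 1 /2⌋)
mainTheorem2 = even , odd
  where
  even : ∀ d₂ → d₂ ≥ 1 → 2 ∣ d₂ →
    ¬ IsLinked (K (1 + 1) □ K (d₂ + 1)) ⌊ 1 + d₂ + 1 /2⌋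
  -- Quotient zero is excluded by `d₂ ≥ 1`. Of the 2q + 3 columns, q + 2 are occupied, one for each
  -- pair, and q + 1 are free.
  even _ _ (divides-refl (suc q)) =
    subst₂ (λ n k → ¬ IsLinked (K 2 □ K n) k) order≡ (sym (size≡ (suc q)))
      (K²□K¬linked q)
    where
    order≡ : suc (suc q) + suc q ≡ suc q * 2 + 1
    order≡ = sym (trans (+-comm (suc q * 2) 1) (cong suc (n*2≡n+n (suc q))))

    size≡ : ∀ n → ⌊ 1 + n * 2 + 1 /2⌋ ≡ suc n
    size≡ 0       = refl
    size≡ (suc n) = cong suc (size≡ n)

  odd : ∀ d₂ → d₂ ∈ (1 ∷ 3 ∷ 5 ∷ 7 ∷ 9 ∷ []) →
    ¬ IsLinked (K (2 + 1) □ K (d₂ + 1)) ⌊ 2 + d₂ + 1 /2⌋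
  odd _ (here refl)                                 = K³□K²¬linked
  odd _ (there (here refl))                         = K³□K⁴¬linked
  odd _ (there (there (here refl)))                 = K³□K⁶¬linked
  odd _ (there (there (there (here refl))))         = K³□K⁸¬linked
  odd _ (there (there (there (there (here refl))))) = K³□K¹⁰¬linked
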